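{- Let $\mathbb X$ be an $L$-structure with $|X|=\kappa\ge\omega$. The following are equivalent: (a) $\mathbb X$ is not reversible; (b) there exists a $\kappa$-closed back and forth system $\Pi\subseteq\mathrm{PC}(\mathbb X)$ containing a bad condensation. Moreover, if $\kappa=\omega$, these are also equivalent to: (c) there exists a back and forth system $\Pi\subseteq\mathrm{PC}(\mathbb X)$ containing a bad condensation.
   Context: $L=\langle R_i:i\in I\rangle$ is a relational language, $R_i$ of arity $n_i$; for an $L$-structure $\mathbb X$ with domain $X$, $R_i^{\mathbb X}$ is the interpretation of $R_i$. For a map $f$ and tuple $\bar x=\langle x_0,\dots,x_{k-1}\rangle$ write $f\bar x=\langle f(x_0),\dots,f(x_{k-1})\rangle$. A partial condensation from $\mathbb X$ to $\mathbb Y$ is a bijection $f$ from a set $\operatorname{dom}f\subseteq X$ onto a set $\operatorname{ran}f\subseteq Y$ such that for all $i\in I$ and $\bar x\in(\operatorname{dom}f)^{n_i}$, $\bar x\in R_i^{\mathbb X}$ implies $f\bar x\in R_i^{\mathbb Y}$; $\mathrm{PC}(\mathbb X,\mathbb Y)$ is the set of these and $\mathrm{PC}(\mathbb X)=\mathrm{PC}(\mathbb X,\mathbb X)$. A condensation is a partial condensation with domain $X$ and range $Y$. $\mathbb X$ is reversible iff every condensation from $\mathbb X$ onto $\mathbb X$ is an automorphism of $\mathbb X$. A finite $f\in\mathrm{PC}(\mathbb X)$ is bad iff there is no automorphism $F$ of $\mathbb X$ with $f\subseteq F$. A back and forth system (b.f.s.) is a nonempty $\Pi\subseteq\mathrm{PC}(\mathbb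 X,\mathbb Y)$ such that (e1) for all $f\in\Pi$ and $x\in X$ there is $g\in\Pi$ with $f\subseteq g$ and $x\in\operatorname{dom}g$, and (e2) for all $f\in\Pi$ and $y\in Y$ there is $g\in\Pi$ with $f\subseteq g$ and $y\in\operatorname{ran}g$. A partial order $\langle P,\le\rangle$ is $\kappa$-closed if for every ordinal $\gamma<\kappa$ and every sequence $\langle p_\alpha:\alpha<\gamma\rangle$ in $P$ with $p_\beta\le p_\alpha$ whenever $\alpha<\beta<\gamma$, there is $p\in P$ with $p\le p_\alpha$ for all $\alpha<\gamma$. A b.f.s. $\Pi$ is $\kappa$-closed if $\langle\Pi,\supseteq\rangle$ is $\kappa$-closed. -}

module Defs where

open import Data.List.Base using (List)
open import Data.List.Membership.Propositional using (_∈_)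
open import Data.Nat.Base using (ℕ)
open import Data.Product using (Σ; ∃-syntax; _×_; _,_; proj₁; proj₂)
open import Data.Vec.Base using (Vec)
open import Data.Vec.Relation.Binary.Pointwise.Inductive using (Pointwise)
open import Function.Base using (id)
open import Function.Bundles using (_⇔_; _⤖_)
open import Induction.WellFounded using (WellFounded)
open import Level using (Level; suc; _⊔_)
open import Relation.Binary.Bundles using (Poset)
open import Relation.Binary.Core using (REL; Rel; _⇒_)
open import Relation.Binary.Definitions using (Irrelevant; _Respects_)
open import Relation.Binary.PropositionalEquality using (_≡_)
open import Relation.Binary.Structures using (IsStrictTotalOrder)
open import Relation.Nullary.Negation using (¬_)
open import Relation.Unary using (Pred; Satisfiable)

-- Relational languages and structures

record Language (ℓ : Level) : Set (suc ℓ) where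
  field
    Index : Set ℓ
    arity : Index → ℕ

open Language public

record Structure {ℓ : Level} (L : Language ℓ) : Set (suc ℓ) where
  field
    Carrier : Set ℓ
    rel     : (i : Index L) → Pred (Vec Carrier (arity L i)) ℓ

open Structure public

module _ {ℓ : Level} {L : Language ℓ} where

  -- A partial map is represented by its graph, as in set theory.  For tuples
  -- x̄ and ȳ, "x̄ lies in (dom f)ⁿ and ȳ = f x̄" is  Pointwise (graph f) x̄ ȳ.

  record PC (𝕏 𝕐 : Structure L) : Set (suc ℓ) where
    field
      graph      : REL (Carrier 𝕏) (Carrier 𝕐) ℓ
      functional : ∀ {x y y′} → graph x y → graph x y′ → y ≡ y′
      injective  : ∀ {x x′ y} → graph x y → graph x′ y → x ≡ x′
      preserves  : ∀ i {x̄ ȳ} → Pointwise graph x̄ ȳ → rel 𝕏 i x̄ → rel 𝕐 i ȳ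

  open PC public

  module _ {𝕏 𝕐 : Structure L} where

    dom : PC 𝕏 𝕐 → Pred (Carrier 𝕏) ℓ
    dom f x = ∃[ y ] graph f x y

    ran : PC 𝕏 𝕐 → Pred (Carrier 𝕐) ℓ
    ran f y = ∃[ x ] graph f x y

    infix 4 _⊑_ _≈_

    _⊑_ : Rel (PC 𝕏 𝕐) ℓ
    f ⊑ g = graph f ⇒ graph g

    _≈_ : Rel (PC 𝕏 𝕐) ℓ
    f ≈ g = f ⊑ g × g ⊑ f

    IsCondensation : Pred (PC 𝕏 𝕐) ℓ
    IsCondensation f = (∀ x → dom f x) × (∀ y → ran f y)

    IsIsomorphism : Pred (PC 𝕏 𝕐) ℓ
    IsIsomorphism f = IsCondensation f ×
      (∀ i {x̄ ȳ} → Pointwise (graph f) x̄ ȳ → rel 𝕏 i x̄ ⇔ rel 𝕐 i ȳ)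

    IsFinite : Pred (PC 𝕏 𝕐) ℓ
    IsFinite f = Σ (List (Carrier 𝕏 × Carrier 𝕐)) λ ps →
      ∀ {x y} → graph f x y ⇔ (x , y) ∈ ps

  IsAutomorphism : {𝕏 : Structure L} → Pred (PC 𝕏 𝕏) ℓ
  IsAutomorphism = IsIsomorphism

  Reversible : Structure L → Set (suc ℓ)
  Reversible 𝕏 = (f : PC 𝕏 𝕏) → IsCondensation f → IsAutomorphism f

  Bad : {𝕏 : Structure L} → Pred (PC 𝕏 𝕏) (suc ℓ)
  Bad {𝕏} f = IsFinite f × ¬ (∃[ F ] IsAutomorphism {𝕏} F × f ⊑ F)

  -- A set of partial condensations is a predicate that does not distinguish
  -- partial condensations with the same graph; hence the field `respects-≈`.

  record IsBFS (𝕏 𝕐 : Structure L) (Π : Pred (PC 𝕏 𝕐) ℓ) : Set (suc ℓ) where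
    field
      respects-≈ : Π Respects _≈_
      nonempty   : Satisfiable Π
      e1         : ∀ f → Π f → ∀ x → ∃[ g ] Π g × f ⊑ g × dom g x
      e2         : ∀ f → Π f → ∀ y → ∃[ g ] Π g × f ⊑ g × ran g y

  -- ⟨Π, ⊇⟩: smaller elements are larger partial maps.

  ⊇-poset : {𝕏 𝕐 : Structure L} → Pred (PC 𝕏 𝕐) ℓ → Poset (suc ℓ) ℓ ℓ
  ⊇-poset Π = record
    { Carrier        = Σ _ Π
    ; _≈_            = λ f g → proj₁ f ≈ proj₁ g
    ; _≤_            = λ f g → proj₁ g ⊑ proj₁ f
    ; isPartialOrder = record
      { isPreorder = record
        { isEquivalence = record
          { refl  = id , id
          ; sym   = λ (p , q) → q , p
          ; trans = λ (p , q) (p′ , q′) → (λ r → p′ (p r)) , (λ r → q (q′ r))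
          }
        ; reflexive = proj₂
        ; trans     = λ p q r → p (q r)
        }
      ; antisym = λ p q → q , p
      }
    }

-- Ordinals are well-ordered types.  Irrelevance of _<_ makes `↓ γ` a genuine
-- subset of the ordinal, counting every α < γ exactly once.

record Ordinal (ℓ : Level) : Set (suc ℓ) where
  infix 4 _<_
  field
    Point              : Set ℓ
    _<_                : Rel Point ℓ
    isStrictTotalOrder : IsStrictTotalOrder _≡_ _<_
    <-wellFounded      : WellFounded _<_
    <-irrelevant       : Irrelevant _<_

  -- As γ runs over Point, ↓ γ runs over the ordinals smaller than this one.

  ↓ : Point → Set ℓ
  ↓ γ = ∃[ α ] α < γ

open Ordinal public using (Point)

IsCardinal : {ℓ : Level} → Ordinal ℓ → Set ℓ
IsCardinal κ = ∀ γ → ¬ (Ordinal.↓ κ γ ⤖ Point κ)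

IsClosed : {k a ℓ₁ ℓ₂ : Level} → Ordinal k → Poset a ℓ₁ ℓ₂ → Set (k ⊔ a ⊔ ℓ₂)
IsClosed κ P = ∀ γ (p : ↓ γ → Poset.Carrier P) →
  (∀ α β → proj₁ α < proj₁ β → p β ≤ p α) →
  ∃[ q ] (∀ α → q ≤ p α)
  where
  open Ordinal κ using (↓; _<_)
  open Poset P using (_≤_)

{-# OPTIONS --safe #-}

-- If 𝕏 is not reversible, fix a condensation f that is not an automorphism
-- and a tuple x̄ outside some R_i with f x̄ in R_i.  The set of all g ⊆ f is a
-- κ-closed back and forth system, f itself being a lower bound of everything,
-- and the restriction of f to x̄ is bad.
--
-- Conversely, starting from a bad f in Π, build along an enumeration of 𝕏 an
-- increasing chain in Π whose members take each element of 𝕏 into their domain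
-- and range, passing limits by κ-closedness (for κ = ω there are none).  As
-- relations are finitary, the union of the chain is a condensation; it extends
-- f, so it is not an automorphism.

module Submission where

open import Defs
open import Axiom.ExcludedMiddle using (ExcludedMiddle)
open import Axiom.Extensionality.Propositional using (Extensionality)
open import Data.List.Base using (List)
open import Data.List.Membership.Propositional using (_∈_)
open import Data.List.Relation.Unary.Any using (here; there)
open import Data.Nat.Base as ℕ using (ℕ; zero)
import Data.Nat.Properties as ℕ
open import Data.Product using (Σ; ∃-syntax; _×_; _,_; proj₁; proj₂)
open import Data.Sum.Base using (_⊎_; inj₁; inj₂)
open import Data.Vec.Base using (Vec; []; _∷_; toList; zip)
open import Data.Vec.Relation.Binary.Pointwise.Inductive as Pointwise
  using (Pointwise; []; _∷_)
open import Function.Base using (id; _∘_)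
open import Function.Bundles using (_⇔_; _⤖_; _↣_; mk⇔; module Bijection; module Equivalence; module Injection)
open import Function.Construct.Composition using (_⤖-∘_)
open import Induction.WellFounded using (module FixPoint; module All)
open import Level using (Level; Lift; lift; lower; suc)
open import Relation.Binary.Core using (REL; _⇒_)
open import Relation.Binary.Definitions using (tri<; tri≈; tri>)
open import Relation.Binary.PropositionalEquality using (_≡_; refl; sym; cong; subst)
open import Relation.Binary.Structures using (IsStrictTotalOrder)
open import Relation.Nullary.Decidable using (Dec; yes; no; map′; decidable-stable)
open import Relation.Nullary.Negation using (¬_; contradiction)
open import Relation.Unary using (Pred)

lower-em : ∀ {ℓ} → ExcludedMiddle (suc ℓ) → ExcludedMiddle ℓ
lower-em {ℓ} em = map′ lower lift (em {Lift (suc ℓ) _})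

module _ {a b} {A : Set a} {B : Set b} where

  to⁻∘to : (e : A ⤖ B) → ∀ x → Bijection.to⁻ e (Bijection.to e x) ≡ x
  to⁻∘to e x = Bijection.injective e (proj₂ (Bijection.strictlySurjective e (Bijection.to e x)))

  Pointwise-zip : ∀ {n} (xs : Vec A n) (ys : Vec B n) →
    Pointwise (λ x y → (x , y) ∈ toList (zip xs ys)) xs ys
  Pointwise-zip []       []       = []
  Pointwise-zip (x ∷ xs) (y ∷ ys) =
    here refl ∷ Pointwise.map there (Pointwise-zip xs ys)

  ∈-zip⁻ : ∀ {ℓ} {R : REL A B ℓ} {n} {xs : Vec A n} {ys : Vec B n} →
    Pointwise R xs ys → ∀ {x y} → (x , y) ∈ toList (zip xs ys) → R x y
  ∈-zip⁻ (r ∷ _)  (here refl) = r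
  ∈-zip⁻ (_ ∷ rs) (there m)   = ∈-zip⁻ rs m

module _ {ℓ} {L : Language ℓ} where

  restrict : {𝕏 𝕐 : Structure L} (f : PC 𝕏 𝕐) (R : REL (Carrier 𝕏) (Carrier 𝕐) ℓ) →
    R ⇒ graph f → PC 𝕏 𝕐
  restrict f R R⊆f = record
    { graph      = R
    ; functional = λ r r′ → functional f (R⊆f r) (R⊆f r′)
    ; injective  = λ r r′ → injective f (R⊆f r) (R⊆f r′)
    ; preserves  = λ i rs → preserves f i (Pointwise.map R⊆f rs)
    }

  -- Unions of chains and one-point extensions

  module _ {𝕏 𝕐 : Structure L} where

    IsChain : {I : Set ℓ} → (I → PC 𝕏 𝕐) → Set ℓ
    IsChain p = ∀ i j → p i ⊑ p j ⊎ p j ⊑ p i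

    module Union {I : Set ℓ} (i₀ : I) (p : I → PC 𝕏 𝕐) (chain : IsChain p) where

      ⋃-graph : REL (Carrier 𝕏) (Carrier 𝕐) ℓ
      ⋃-graph x y = ∃[ i ] graph (p i) x y

      join : ∀ i j → ∃[ k ] (p i ⊑ p k × p j ⊑ p k)
      join i j with chain i j
      ... | inj₁ i⊑j = j , (λ r → i⊑j r) , id
      ... | inj₂ j⊑i = i , id , (λ r → j⊑i r)

      -- A tuple has finitely many entries, so by directedness one member of the chain contains all
      -- the pairs. The index `i₀` serves the empty tuple, which occurs for nullary relations.
      ⋃-tuple : ∀ {m n} {x̄ : Vec (Carrier 𝕏) m} {ȳ : Vec (Carrier 𝕐) n} →
        Pointwise ⋃-graph x̄ ȳ → ∃[ i ] Pointwise (graph (p i)) x̄ ȳ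
      ⋃-tuple []             = i₀ , []
      ⋃-tuple ((i , r) ∷ rs) with ⋃-tuple rs
      ... | j , rs′ with join i j
      ... | k , i⊑k , j⊑k = k , i⊑k r ∷ Pointwise.map j⊑k rs′

      ⋃ : PC 𝕏 𝕐
      ⋃ = record
        { graph      = ⋃-graph
        ; functional = λ (i , r) (j , s) → let k , i⊑k , j⊑k = join i j in
                         functional (p k) (i⊑k r) (j⊑k s)
        ; injective  = λ (i , r) (j , s) → let k , i⊑k , j⊑k = join i j in
                         injective (p k) (i⊑k r) (j⊑k s)
        ; preserves  = λ i rs → let j , rs′ = ⋃-tuple rs in preserves (p j) i rs′
        }

    module Extend {Π : Pred (PC 𝕏 𝕐) ℓ} (bfs : IsBFS 𝕏 𝕐 Π) where
      open IsBFS bfs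

      forth : (g : Σ _ Π) (x : Carrier 𝕏) → ∃[ h ] Π h × proj₁ g ⊑ h × dom h x
      forth (g , πg) x = e1 g πg x

      back : (g : Σ _ Π) (y : Carrier 𝕐) → ∃[ h ] Π h × proj₁ g ⊑ h × ran h y
      back (g , πg) y = e2 g πg y

      extend : Σ _ Π → Carrier 𝕏 → Carrier 𝕐 → Σ _ Π
      extend g x y = let h , πh , _ = forth g x
                         k , πk , _ = back (h , πh) y
                     in k , πk

      module _ (g : Σ _ Π) (x : Carrier 𝕏) (y : Carrier 𝕐) where
        private
          h = forth g x
          k = back (proj₁ h , proj₁ (proj₂ h)) y
          h⊑k = proj₁ (proj₂ (proj₂ k))

        ⊑-extend : proj₁ g ⊑ proj₁ (extend g x y)
        ⊑-extend r = h⊑k (proj₁ (proj₂ (proj₂ h)) r)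

        extend-dom : dom (proj₁ (extend g x y)) x
        extend-dom = let z , r = proj₂ (proj₂ (proj₂ h)) in z , h⊑k r

        extend-ran : ran (proj₁ (extend g x y)) y
        extend-ran = proj₂ (proj₂ (proj₂ k))

  -- From a bad condensation to non-reversibility

  module _ {𝕏 : Structure L} where

    -- Reversibility would turn the union of the chain into an automorphism extending `f`. The chain
    -- is indexed by the carrier so that chains of length ω and of length κ both fit, after
    -- reindexing along the enumeration.
    bad-chain⇒¬reversible : (f : PC 𝕏 𝕏) → Bad f →
      Carrier 𝕏 → (p : Carrier 𝕏 → PC 𝕏 𝕏) → IsChain p →
      (∀ x → f ⊑ p x) → (∀ x → dom (p x) x) → (∀ x → ran (p x) x) → ¬ Reversible 𝕏
    bad-chain⇒¬reversible f (_ , noExt) x₀ p chain f⊑p p-dom p-ran reversible =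
      noExt (⋃ , reversible ⋃ isCondensation , λ r → x₀ , f⊑p x₀ r)
      where
      open Union x₀ p chain
      isCondensation : IsCondensation ⋃
      isCondensation = (λ x → let y , r = p-dom x in y , x , r)
                     , (λ y → let x , r = p-ran y in x , y , r)

    module _ {Π : Pred (PC 𝕏 𝕏) ℓ} (bfs : IsBFS 𝕏 𝕏 Π) (f : Σ _ Π) (bad : Bad (proj₁ f)) where
      open Extend bfs

      module Countable (code : Carrier 𝕏 ⤖ ℕ) where
        open Bijection code using (to; to⁻)

        p : ℕ → Σ _ Π
        p zero      = f
        p (ℕ.suc n) = extend (p n) (to⁻ n) (to⁻ n)

        p-mono : ∀ {m n} → m ℕ.≤′ n → proj₁ (p m) ⊑ proj₁ (p n)
        p-mono ℕ.≤′-refl       r = r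
        p-mono (ℕ.≤′-step m≤n) r = ⊑-extend _ _ _ (p-mono m≤n r)

        ¬reversible : ¬ Reversible 𝕏
        ¬reversible = bad-chain⇒¬reversible (proj₁ f) bad (to⁻ 0) q chain
          (λ x r → p-mono (ℕ.≤⇒≤′ ℕ.z≤n) r)
          (λ x → subst (dom (q x)) (to⁻∘to code x) (extend-dom _ _ _))
          (λ x → subst (ran (q x)) (to⁻∘to code x) (extend-ran _ _ _))
          where
          q : Carrier 𝕏 → PC 𝕏 𝕏
          -- The element with code n is treated in passing from stage n to stage n + 1, hence the
          -- successor.
          q x = proj₁ (p (ℕ.suc (to x)))
          chain : IsChain q
          chain x y with ℕ.≤-total (to x) (to y)
          ... | inj₁ x≤y = inj₁ (λ r → p-mono (ℕ.≤⇒≤′ (ℕ.s≤s x≤y)) r)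
          ... | inj₂ y≤x = inj₂ (λ r → p-mono (ℕ.≤⇒≤′ (ℕ.s≤s y≤x)) r)

      module Transfinite (em : ExcludedMiddle ℓ) (ext : Extensionality ℓ (suc ℓ))
        (κ : Ordinal ℓ) (closed : IsClosed κ (⊇-poset Π))
        (γ₀ : Point κ) (code : Carrier 𝕏 ⤖ Point κ) where
        open Ordinal κ using (_<_; ↓; isStrictTotalOrder; <-wellFounded)
        open Bijection code using (to; to⁻)

        Increasing : ∀ {γ} → (↓ γ → Σ _ Π) → Set ℓ
        Increasing s = ∀ α β → proj₁ α < proj₁ β → proj₁ (s α) ⊑ proj₁ (s β)

        -- At the least ordinal the bound is f, so that the whole chain lies above f;
        -- the value f on sequences that are not increasing is junk.
        bound : ∀ {γ} (s : ↓ γ → Σ _ Π) → Dec (Increasing s × ↓ γ) → Σ _ Π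
        bound s (yes (s↗ , _)) = proj₁ (closed _ s s↗)
        bound s (no _)         = f

        ⊑-bound : ∀ {γ} (s : ↓ γ → Σ _ Π) d → Increasing s →
          ∀ α → proj₁ (s α) ⊑ proj₁ (bound s d)
        ⊑-bound s (yes (s↗ , _)) _  α = proj₂ (closed _ s s↗) α
        ⊑-bound s (no ¬p)        s↗ α = contradiction (s↗ , α) ¬p

        f⊑bound : ∀ {γ} (s : ↓ γ → Σ _ Π) d → (∀ α → proj₁ f ⊑ proj₁ (s α)) →
          proj₁ f ⊑ proj₁ (bound s d)
        f⊑bound s (yes (s↗ , α)) f⊑s r = proj₂ (closed _ s s↗) α (f⊑s α r)
        f⊑bound s (no _)         f⊑s r = r

        -- Bounding all earlier stages before extending treats zero, successors and limits alike.
        -- The sequence `s` is arbitrary, since the recursion cannot yet know that its values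
        -- increase; `em` decides this.
        step : ∀ γ → (↓ γ → Σ _ Π) → Σ _ Π
        step γ s = extend (bound s em) (to⁻ γ) (to⁻ γ)

        recurse : ∀ γ → (∀ {α} → α < γ → Σ _ Π) → Σ _ Π
        recurse γ s = step γ (λ (_ , α<γ) → s α<γ)

        p : Point κ → Σ _ Π
        p = All.wfRec <-wellFounded (suc ℓ) (λ _ → Σ _ Π) recurse

        p-unfold : ∀ γ → p γ ≡ step γ (p ∘ proj₁)
        p-unfold γ = FixPoint.unfold-wfRec <-wellFounded (λ _ → Σ _ Π) recurse
          -- The bound chosen by `closed` and the decision by `em` depend on the sequence as a
          -- whole, so pointwise equality has to become equality of functions.
          (λ γ s≡t → cong (step γ) (ext λ (_ , α<γ) → s≡t α<γ))

        AboveEarlier : Point κ → Set ℓ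
        AboveEarlier γ = proj₁ f ⊑ proj₁ (p γ) × (∀ {α} → α < γ → proj₁ (p α) ⊑ proj₁ (p γ))

        -- The hypothesis at all β < γ says that the sequence below γ increases and lies above `f`.
        -- Hence `bound` takes its default only at the least ordinal and otherwise is a true bound,
        -- which `p γ` extends.
        aboveEarlier : ∀ γ → AboveEarlier γ
        aboveEarlier = All.wfRec <-wellFounded ℓ AboveEarlier λ γ ih →
          let s  = p ∘ proj₁
              s↗ = λ (α : ↓ γ) β α<β {x} {y} → proj₂ (ih (proj₂ β)) α<β {x} {y}
          in subst (λ g → proj₁ f ⊑ proj₁ g × (∀ {α} → α < γ → proj₁ (p α) ⊑ proj₁ g))
               (sym (p-unfold γ))
               ( (λ r → ⊑-extend _ _ _ (f⊑bound s em (λ α → proj₁ (ih (proj₂ α))) r))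
               , (λ α<γ r → ⊑-extend _ _ _ (⊑-bound s em s↗ (_ , α<γ) r)))

        ¬reversible : ¬ Reversible 𝕏
        ¬reversible = bad-chain⇒¬reversible (proj₁ f) bad (to⁻ γ₀) q chain
          (λ x r → proj₁ (aboveEarlier (to x)) r)
          (λ x → subst (dom (q x)) (to⁻∘to code x) (p-dom (to x)))
          (λ x → subst (ran (q x)) (to⁻∘to code x) (p-ran (to x)))
          where
          q : Carrier 𝕏 → PC 𝕏 𝕏
          q x = proj₁ (p (to x))
          p-dom : ∀ γ → dom (proj₁ (p γ)) (to⁻ γ)
          p-dom γ = subst (λ g → dom (proj₁ g) (to⁻ γ)) (sym (p-unfold γ)) (extend-dom _ _ _)
          p-ran : ∀ γ → ran (proj₁ (p γ)) (to⁻ γ)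
          p-ran γ = subst (λ g → ran (proj₁ g) (to⁻ γ)) (sym (p-unfold γ)) (extend-ran _ _ _)
          chain : IsChain q
          chain x y with to x | to y | IsStrictTotalOrder.compare isStrictTotalOrder (to x) (to y)
          ... | _ | β | tri< α<β _ _  = inj₁ (λ r → proj₂ (aboveEarlier β) α<β r)
          ... | _ | _ | tri≈ _ refl _ = inj₁ id
          ... | α | _ | tri> _ _ β<α  = inj₂ (λ r → proj₂ (aboveEarlier α) β<α r)

    -- From non-reversibility to a bad condensation

    bad-restriction : (f : PC 𝕏 𝕏) → ∀ i {x̄ ȳ} → Pointwise (graph f) x̄ ȳ →
      ¬ rel 𝕏 i x̄ → rel 𝕏 i ȳ → ∃[ g ] g ⊑ f × Bad g
    bad-restriction f i {x̄} {ȳ} rs x̄∉R ȳ∈R = g , g⊑f , (ps , mk⇔ id id) , noExt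
      where
      ps : List (Carrier 𝕏 × Carrier 𝕏)
      ps = toList (zip x̄ ȳ)
      g : PC 𝕏 𝕏
      -- With list membership as the graph, finiteness is immediate. Repeated entries of the tuple
      -- are harmless, as all the pairs lie in `f`.
      g = restrict f (λ x y → (x , y) ∈ ps) (∈-zip⁻ rs)
      g⊑f : g ⊑ f
      g⊑f = ∈-zip⁻ rs
      noExt : ¬ (∃[ F ] IsAutomorphism {𝕏 = 𝕏} F × g ⊑ F)
      noExt (F , (_ , iso) , g⊑F) =
        -- `F` also sends x̄ to ȳ, and an automorphism reflects relations.
        x̄∉R (Equivalence.from (iso i (Pointwise.map g⊑F (Pointwise-zip x̄ ȳ))) ȳ∈R)

    -- If no condensation had a bad restriction, every condensation would reflect all relations,
    -- since a single failure gives one by `bad-restriction`.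
    ¬reversible⇒bad-condensation : ExcludedMiddle (suc ℓ) → ¬ Reversible 𝕏 →
      ∃[ f ] IsCondensation f × (∃[ g ] g ⊑ f × Bad g)
    ¬reversible⇒bad-condensation em ¬rev = decidable-stable em λ none → ¬rev λ f cond →
      cond , λ i rs → mk⇔ (preserves f i rs) λ ȳ∈R →
        decidable-stable (lower-em em) λ x̄∉R →
          none (f , cond , bad-restriction f i rs x̄∉R ȳ∈R)

    -- As `f` is total, onto and above every member, it answers every instance of `e1` and `e2`.
    restrictions-isBFS : (f : PC 𝕏 𝕏) → IsCondensation f → IsBFS 𝕏 𝕏 (_⊑ f)
    restrictions-isBFS f (total , onto) = record
      { respects-≈ = λ g≈h g⊑f r → g⊑f (proj₂ g≈h r)
      ; nonempty   = f , id
      ; e1         = λ g g⊑f x → f , id , (λ r → g⊑f r) , total x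
      ; e2         = λ g g⊑f y → f , id , (λ r → g⊑f r) , onto y
      }

theorem3p4 : {ℓ : Level} →
    ExcludedMiddle (suc ℓ) → Extensionality ℓ (suc ℓ) →
    (L : Language ℓ) (𝕏 : Structure L) (κ : Ordinal ℓ) →
    IsCardinal κ → ℕ ↣ Point κ → Carrier 𝕏 ⤖ Point κ →
    ((¬ Reversible 𝕏) ⇔
    (∃[ Π ] IsBFS 𝕏 𝕏 Π × IsClosed κ (⊇-poset Π) × (∃[ f ] Π f × Bad f)))
    ×
    (Point κ ⤖ ℕ →
    ((¬ Reversible 𝕏) ⇔
    (∃[ Π ] IsBFS 𝕏 𝕏 Π × (∃[ f ] Π f × Bad f))))
theorem3p4 em ext L 𝕏 κ _ ℕ↣κ X⤖κ =
  mk⇔ a⇒b b⇒a , λ κ⤖ℕ → mk⇔ a⇒c (c⇒a κ⤖ℕ)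
  where
  a⇒b : ¬ Reversible 𝕏 →
    ∃[ Π ] IsBFS 𝕏 𝕏 Π × IsClosed κ (⊇-poset Π) × (∃[ f ] Π f × Bad f)
  a⇒b ¬rev with ¬reversible⇒bad-condensation em ¬rev
  ... | f , cond , g , g⊑f , bad =
    (_⊑ f) , restrictions-isBFS f cond , (λ γ s _ → (f , id) , λ α → proj₂ (s α)) , g , g⊑f , bad

  b⇒a : (∃[ Π ] IsBFS 𝕏 𝕏 Π × IsClosed κ (⊇-poset Π) × (∃[ f ] Π f × Bad f)) →
    ¬ Reversible 𝕏
  b⇒a (Π , bfs , closed , f , πf , bad) =
    -- Infinity of κ supplies a point, hence an index at which the union is seen to contain `f`.
    Transfinite.¬reversible bfs (f , πf) bad (lower-em em) ext κ closed (Injection.to ℕ↣κ 0) X⤖κ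

  a⇒c : ¬ Reversible 𝕏 → ∃[ Π ] IsBFS 𝕏 𝕏 Π × (∃[ f ] Π f × Bad f)
  a⇒c ¬rev with a⇒b ¬rev
  ... | Π , bfs , _ , f = Π , bfs , f

  c⇒a : Point κ ⤖ ℕ → (∃[ Π ] IsBFS 𝕏 𝕏 Π × (∃[ f ] Π f × Bad f)) → ¬ Reversible 𝕏
  c⇒a κ⤖ℕ (Π , bfs , f , πf , bad) =
    Countable.¬reversible bfs (f , πf) bad (κ⤖ℕ ⤖-∘ X⤖κ)
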